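{- Up to isomorphism, there are exactly $10$ core graphs on $7$ vertices, namely: $K_7$, $C_7$, $\overline{C_7}$, $C_5+2$, and the graphs $G_1,\dots,G_6$ defined as follows. Each $G_i$ has vertex set $\{a,b,c,d,e,u,v\}$ and contains the $5$-cycle edges $ab,bc,cd,de,ea$, together with the following edges: $G_1$: $ua,ub,uc,va,ve,vd$ (11 edges); $G_2$: $ua,ub,uc,va,ve,vc,vd$ (12 edges); $G_3$: $ua,ub,uc,ud,va,ve,vc,vd$ (13 edges); $G_4$: $ua,ub,uc,va,ve,vd,uv$ (12 edges); $G_5$: $ua,ub,ue,ud,va,ve,vc$ (12 edges); $G_6$: $ua,ub,ue,ud,va,ve,vc,vd$ (13 edges).
   Context: Graphs are finite, simple, undirected, loopless. A graph $H$ is a core if every homomorphism (edge-preserving map) $H\to H$ is bijective. $K_7$ is the complete graph, $C_7$ the $7$-cycle, $\overline{C_7}$ its complement, and $C_5+2$ is obtained from the $5$-cycle $C_5$ by adding two new vertices adjacent to each other and to all vertices of $C_5$. -}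

module Defs where

open import Data.Nat using (ℕ; _≡ᵇ_)
open import Data.Bool using (Bool; true; false; _∧_; _∨_)
open import Data.Bool.Properties using (∨-comm)
open import Data.Fin using (Fin; toℕ; #_)
open import Data.List using (List; []; _∷_)
open import Data.Bool.ListAction using (any)
open import Data.Product using (_×_; _,_; Σ; ∃)
open import Relation.Binary.PropositionalEquality using (_≡_; refl)
open import Function.Definitions using (Bijective)

record Graph (n : ℕ) : Set where
  field
    adj    : Fin n → Fin n → Bool
    sym    : ∀ x y → adj x y ≡ adj y x
    irrefl : ∀ x → adj x x ≡ false
open Graph public

IsHom : ∀ {m n} → Graph m → Graph n → (Fin m → Fin n) → Set
IsHom G H f = ∀ x y → adj G x y ≡ true → adj H (f x) (f y) ≡ true

IsCore : ∀ {n} → Graph n → Set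
IsCore {n} H = (f : Fin n → Fin n) → IsHom H H f → Bijective _≡_ _≡_ f

_≅_ : ∀ {n} → Graph n → Graph n → Set
_≅_ {n} G H = Σ (Fin n → Fin n) λ f →
  Bijective _≡_ _≡_ f × (∀ x y → adj G x y ≡ adj H (f x) (f y))

-- Graphs on 7 vertices from explicit edge lists.
-- Vertex labels: a = 0, b = 1, c = 2, d = 3, e = 4, u = 5, v = 6.

Edge : Set
Edge = Fin 7 × Fin 7

hasEdge : List Edge → Fin 7 → Fin 7 → Bool
hasEdge es x y = any (λ { (p , q) → (toℕ x ≡ᵇ toℕ p) ∧ (toℕ y ≡ᵇ toℕ q) }) es

edgeAdj : List Edge → Fin 7 → Fin 7 → Bool
edgeAdj es x y = hasEdge es x y ∨ hasEdge es y x

private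
  irr7 : (f : Fin 7 → Bool) →
         f (# 0) ≡ false → f (# 1) ≡ false → f (# 2) ≡ false →
         f (# 3) ≡ false → f (# 4) ≡ false → f (# 5) ≡ false →
         f (# 6) ≡ false → ∀ x → f x ≡ false
  irr7 f p0 p1 p2 p3 p4 p5 p6 Fin.zero = p0
  irr7 f p0 p1 p2 p3 p4 p5 p6 (Fin.suc Fin.zero) = p1
  irr7 f p0 p1 p2 p3 p4 p5 p6 (Fin.suc (Fin.suc Fin.zero)) = p2
  irr7 f p0 p1 p2 p3 p4 p5 p6 (Fin.suc (Fin.suc (Fin.suc Fin.zero))) = p3
  irr7 f p0 p1 p2 p3 p4 p5 p6 (Fin.suc (Fin.suc (Fin.suc (Fin.suc Fin.zero)))) = p4
  irr7 f p0 p1 p2 p3 p4 p5 p6 (Fin.suc (Fin.suc (Fin.suc (Fin.suc (Fin.suc Fin.zero))))) = p5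
  irr7 f p0 p1 p2 p3 p4 p5 p6 (Fin.suc (Fin.suc (Fin.suc (Fin.suc (Fin.suc (Fin.suc Fin.zero)))))) = p6

mkGraph : (es : List Edge) →
          edgeAdj es (# 0) (# 0) ≡ false → edgeAdj es (# 1) (# 1) ≡ false →
          edgeAdj es (# 2) (# 2) ≡ false → edgeAdj es (# 3) (# 3) ≡ false →
          edgeAdj es (# 4) (# 4) ≡ false → edgeAdj es (# 5) (# 5) ≡ false →
          edgeAdj es (# 6) (# 6) ≡ false → Graph 7
mkGraph es p0 p1 p2 p3 p4 p5 p6 = record
  { adj = edgeAdj es
  ; sym = λ x y → ∨-comm (hasEdge es x y) (hasEdge es y x)
  ; irrefl = irr7 (λ x → edgeAdj es x x) p0 p1 p2 p3 p4 p5 p6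
  }

K₇ : Graph 7
K₇ = mkGraph ((# 0 , # 1) ∷ (# 0 , # 2) ∷ (# 0 , # 3) ∷ (# 0 , # 4) ∷ (# 0 , # 5) ∷ (# 0 , # 6) ∷ (# 1 , # 2) ∷ (# 1 , # 3) ∷ (# 1 , # 4) ∷ (# 1 , # 5) ∷ (# 1 , # 6) ∷ (# 2 , # 3) ∷ (# 2 , # 4) ∷ (# 2 , # 5) ∷ (# 2 , # 6) ∷ (# 3 , # 4) ∷ (# 3 , # 5) ∷ (# 3 , # 6) ∷ (# 4 , # 5) ∷ (# 4 , # 6) ∷ (# 5 , # 6) ∷ []) refl refl refl refl refl refl refl

C₇ : Graph 7
C₇ = mkGraph ((# 0 , # 1) ∷ (# 1 , # 2) ∷ (# 2 , # 3) ∷ (# 3 , # 4) ∷ (# 4 , # 5) ∷ (# 5 , # 6) ∷ (# 6 , # 0) ∷ []) refl refl refl refl refl refl refl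

-- complement of C₇ (pairs at cyclic distance 2 or 3)
coC₇ : Graph 7
coC₇ = mkGraph ((# 0 , # 2) ∷ (# 0 , # 3) ∷ (# 0 , # 4) ∷ (# 0 , # 5) ∷ (# 1 , # 3) ∷ (# 1 , # 4) ∷ (# 1 , # 5) ∷ (# 1 , # 6) ∷ (# 2 , # 4) ∷ (# 2 , # 5) ∷ (# 2 , # 6) ∷ (# 3 , # 5) ∷ (# 3 , # 6) ∷ (# 4 , # 6) ∷ []) refl refl refl refl refl refl refl

-- C₅ + 2: 5-cycle abcde plus adjacent u, v joined to all of C₅
C₅+2 : Graph 7
C₅+2 = mkGraph ((# 0 , # 1) ∷ (# 1 , # 2) ∷ (# 2 , # 3) ∷ (# 3 , # 4) ∷ (# 4 , # 0) ∷ (# 5 , # 0) ∷ (# 5 , # 1) ∷ (# 5 , # 2) ∷ (# 5 , # 3) ∷ (# 5 , # 4) ∷ (# 6 , # 0) ∷ (# 6 , # 1) ∷ (# 6 , # 2) ∷ (# 6 , # 3) ∷ (# 6 , # 4) ∷ (# 5 , # 6) ∷ []) refl refl refl refl refl refl refl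

G₁ : Graph 7
G₁ = mkGraph ((# 0 , # 1) ∷ (# 1 , # 2) ∷ (# 2 , # 3) ∷ (# 3 , # 4) ∷ (# 4 , # 0) ∷ (# 5 , # 0) ∷ (# 5 , # 1) ∷ (# 5 , # 2) ∷ (# 6 , # 0) ∷ (# 6 , # 4) ∷ (# 6 , # 3) ∷ []) refl refl refl refl refl refl refl

G₂ : Graph 7
G₂ = mkGraph ((# 0 , # 1) ∷ (# 1 , # 2) ∷ (# 2 , # 3) ∷ (# 3 , # 4) ∷ (# 4 , # 0) ∷ (# 5 , # 0) ∷ (# 5 , # 1) ∷ (# 5 , # 2) ∷ (# 6 , # 0) ∷ (# 6 , # 4) ∷ (# 6 , # 2) ∷ (# 6 , # 3) ∷ []) refl refl refl refl refl refl refl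

G₃ : Graph 7
G₃ = mkGraph ((# 0 , # 1) ∷ (# 1 , # 2) ∷ (# 2 , # 3) ∷ (# 3 , # 4) ∷ (# 4 , # 0) ∷ (# 5 , # 0) ∷ (# 5 , # 1) ∷ (# 5 , # 2) ∷ (# 5 , # 3) ∷ (# 6 , # 0) ∷ (# 6 , # 4) ∷ (# 6 , # 2) ∷ (# 6 , # 3) ∷ []) refl refl refl refl refl refl refl

G₄ : Graph 7
G₄ = mkGraph ((# 0 , # 1) ∷ (# 1 , # 2) ∷ (# 2 , # 3) ∷ (# 3 , # 4) ∷ (# 4 , # 0) ∷ (# 5 , # 0) ∷ (# 5 , # 1) ∷ (# 5 , # 2) ∷ (# 6 , # 0) ∷ (# 6 , # 4) ∷ (# 6 , # 3) ∷ (# 5 , # 6) ∷ []) refl refl refl refl refl refl refl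

G₅ : Graph 7
G₅ = mkGraph ((# 0 , # 1) ∷ (# 1 , # 2) ∷ (# 2 , # 3) ∷ (# 3 , # 4) ∷ (# 4 , # 0) ∷ (# 5 , # 0) ∷ (# 5 , # 1) ∷ (# 5 , # 4) ∷ (# 5 , # 3) ∷ (# 6 , # 0) ∷ (# 6 , # 4) ∷ (# 6 , # 2) ∷ []) refl refl refl refl refl refl refl

G₆ : Graph 7
G₆ = mkGraph ((# 0 , # 1) ∷ (# 1 , # 2) ∷ (# 2 , # 3) ∷ (# 3 , # 4) ∷ (# 4 , # 0) ∷ (# 5 , # 0) ∷ (# 5 , # 1) ∷ (# 5 , # 4) ∷ (# 5 , # 3) ∷ (# 6 , # 0) ∷ (# 6 , # 4) ∷ (# 6 , # 2) ∷ (# 6 , # 3) ∷ []) refl refl refl refl refl refl refl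

coreGraph : Fin 10 → Graph 7
coreGraph Fin.zero = K₇
coreGraph (Fin.suc Fin.zero) = C₇
coreGraph (Fin.suc (Fin.suc Fin.zero)) = coC₇
coreGraph (Fin.suc (Fin.suc (Fin.suc Fin.zero))) = C₅+2
coreGraph (Fin.suc (Fin.suc (Fin.suc (Fin.suc Fin.zero)))) = G₁
coreGraph (Fin.suc (Fin.suc (Fin.suc (Fin.suc (Fin.suc Fin.zero))))) = G₂
coreGraph (Fin.suc (Fin.suc (Fin.suc (Fin.suc (Fin.suc (Fin.suc Fin.zero)))))) = G₃
coreGraph (Fin.suc (Fin.suc (Fin.suc (Fin.suc (Fin.suc (Fin.suc (Fin.suc Fin.zero))))))) = G₄
coreGraph (Fin.suc (Fin.suc (Fin.suc (Fin.suc (Fin.suc (Fin.suc (Fin.suc (Fin.suc Fin.zero)))))))) = G₅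
coreGraph (Fin.suc (Fin.suc (Fin.suc (Fin.suc (Fin.suc (Fin.suc (Fin.suc (Fin.suc (Fin.suc Fin.zero))))))))) = G₆

{-# OPTIONS --safe #-}
module Submission where

-- The classification is a computation. Deleting a vertex from a 7-vertex graph leaves a 6-vertex
-- graph, so up to isomorphism every 7-vertex graph is a one-vertex extension of a representative of one
-- of the 156 isomorphism classes on 6 vertices; the representatives are found the same way, one vertex
-- at a time. A backtracking search lists the endomorphisms of each of the 156 · 2⁶ extensions: either
-- one of them is not injective, or an isomorphism with one of the ten graphs is found.

open import Defs
open import Data.Fin using (Fin)
open import Data.Product using (_×_; ∃)
open import Function.Bundles using (_⇔_)
open import Relation.Binary.PropositionalEquality using (_≡_)

open import Data.Bool as Bool using (Bool; true; false; T; not; _∧_; _∨_; if_then_else_)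
open import Data.Bool.ListAction using (any; all)
open import Data.Bool.Properties using (T-≡; T-∧; T-∨; T?)
open import Data.Fin using (zero; suc; punchOut)
open import Data.Fin.Properties as Fin using (punchOut-injective; suc-injective; injective⇒≤)
open import Data.List as List using (List; []; _∷_; null; allFin; concatMap; filterᵇ; cartesianProductWith)
open import Data.List.Membership.Propositional using (_∈_; find; lose)
open import Data.List.Membership.Propositional.Properties
  using (∈-allFin; ∈-map⁺; ∈-map⁻; ∈-filter⁺; ∈-filter⁻; ∈-concatMap⁺; ∈-concatMap⁻;
         ∈-cartesianProductWith⁺)
open import Data.List.Relation.Unary.All as All using ()
import Data.List.Relation.Unary.All.Properties as All
open import Data.List.Relation.Unary.Any as Any using (Any; here; there)
import Data.List.Relation.Unary.Any.Properties as Any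
open import Data.Nat using (ℕ; zero; suc; _+_; _^_; _≡ᵇ_)
open import Data.Nat.Properties using (1+n≰n)
open import Data.Product using (_,_; proj₁; proj₂; map₂; ∃-syntax)
open import Data.Sum using (inj₁; inj₂)
open import Data.Vec as Vec using (Vec; []; _∷_; lookup; tabulate)
open import Data.Vec.Properties using (tabulate∘lookup; lookup∘tabulate)
open import Data.Vec.Relation.Unary.AllPairs using (allPairs?)
open import Data.Vec.Relation.Unary.Unique.Propositional using (Unique)
import Data.Vec.Relation.Unary.Unique.Propositional.Properties as Unique
open import Function using (_∘_; id)
open import Function.Bundles using (mk⇔; Equivalence)
open import Function.Definitions using (Injective; Bijective)
open import Relation.Nullary using (¬_; Dec; yes; no; ¬?; contradiction)
open import Relation.Nullary.Decidable using (⌊_⌋; toWitness; fromWitness; decidable-stable; _×-dec_)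
open import Relation.Binary.PropositionalEquality
  using (_≢_; refl; trans; cong; cong₂; subst; module ≡-Reasoning)
  renaming (sym to ≡-sym)

open Equivalence using (to; from)

private
  variable
    m n : ℕ

-- Bijections and isomorphisms

-- Pigeonhole: if `f` missed a value `y`, removing `y` by `punchOut` would squeeze `Fin (suc n)`
-- injectively into `Fin n`.
injective⇒bijective : {f : Fin n → Fin n} → Injective _≡_ _≡_ f → Bijective _≡_ _≡_ f
injective⇒bijective {suc n} {f} f-inj = f-inj , surj
  where
  surj : ∀ y → ∃[ x ] (∀ {z} → z ≡ x → f z ≡ y)
  surj y with Fin.any? (λ x → f x Fin.≟ y)
  ... | yes (x , fx≡y) = x , λ { refl → fx≡y }
  ... | no missed = contradiction (injective⇒≤ {f = λ x → punchOut (y≢f x)} squeezed) 1+n≰n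
    where
    y≢f : ∀ x → y ≢ f x
    y≢f x y≡fx = missed (x , ≡-sym y≡fx)
    squeezed : Injective _≡_ _≡_ (λ x → punchOut (y≢f x))
    squeezed {x} {z} eq = f-inj (punchOut-injective (y≢f x) (y≢f z) eq)
injective⇒bijective {zero} f-inj = f-inj , λ ()

module Inverse {f : Fin n → Fin n} (f-bij : Bijective _≡_ _≡_ f) where
  inv : Fin n → Fin n
  inv y = proj₁ (proj₂ f-bij y)

  f∘inv : ∀ y → f (inv y) ≡ y
  f∘inv y = proj₂ (proj₂ f-bij y) refl

  inv∘f : ∀ x → inv (f x) ≡ x
  inv∘f x = proj₁ f-bij (f∘inv (f x))

  inv-injective : Injective _≡_ _≡_ inv
  inv-injective {x} {y} eq = trans (≡-sym (f∘inv x)) (trans (cong f eq) (f∘inv y))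

≅-sym : (G H : Graph n) → G ≅ H → H ≅ G
≅-sym G H (f , f-bij , f-adj) = inv , injective⇒bijective inv-injective ,
  λ x y → trans (cong₂ (adj H) (≡-sym (f∘inv x)) (≡-sym (f∘inv y))) (≡-sym (f-adj (inv x) (inv y)))
  where open Inverse f-bij

≅-trans : (G H K : Graph n) → G ≅ H → H ≅ K → G ≅ K
≅-trans G H K (f , f-bij , f-adj) (g , g-bij , g-adj) =
  g ∘ f , injective⇒bijective (proj₁ f-bij ∘ proj₁ g-bij) ,
  λ x y → trans (f-adj x y) (g-adj (f x) (f y))

-- Conjugating by `φ` turns an endomorphism of `H` into one of `G`, and injectivity of the conjugate
-- gives that of `f`.
IsCore-resp-≅ : (G H : Graph n) → G ≅ H → IsCore G → IsCore H
IsCore-resp-≅ G H (φ , φ-bij , φ-adj) G-core f f-hom = injective⇒bijective f-inj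
  where
  open Inverse φ-bij
  conjugate-hom : IsHom G G (inv ∘ f ∘ φ)
  conjugate-hom x y e = begin
    adj G (inv (f (φ x))) (inv (f (φ y)))         ≡⟨ φ-adj _ _ ⟩
    adj H (φ (inv (f (φ x)))) (φ (inv (f (φ y)))) ≡⟨ cong₂ (adj H) (f∘inv _) (f∘inv _) ⟩
    adj H (f (φ x)) (f (φ y))                     ≡⟨ f-hom _ _ (trans (≡-sym (φ-adj x y)) e) ⟩
    true                                          ∎
    where open ≡-Reasoning
  f-inj : Injective _≡_ _≡_ f
  f-inj {x} {y} fx≡fy = inv-injective (proj₁ (G-core _ conjugate-hom) (cong inv
    (trans (cong f (f∘inv x)) (trans fx≡fy (≡-sym (cong f (f∘inv y)))))))

-- Graphs as sequences of one-vertex extensions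

infixr 5 _▹_
-- Only the strict upper triangle of the adjacency matrix is stored, row by row, so every code is
-- symmetric and loopless by construction.
data Code : ℕ → Set where
  ∅   : Code 0
  _▹_ : Vec Bool n → Code n → Code (suc n)

edge : Code n → Fin n → Fin n → Bool
edge (r ▹ g) zero    zero    = false
edge (r ▹ g) zero    (suc j) = lookup r j
edge (r ▹ g) (suc i) zero    = lookup r i
edge (r ▹ g) (suc i) (suc j) = edge g i j

edge-sym : (g : Code n) → ∀ i j → edge g i j ≡ edge g j i
edge-sym (r ▹ g) zero    zero    = refl
edge-sym (r ▹ g) zero    (suc j) = refl
edge-sym (r ▹ g) (suc i) zero    = refl
edge-sym (r ▹ g) (suc i) (suc j) = edge-sym g i j

edge-irrefl : (g : Code n) → ∀ i → edge g i i ≡ false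
edge-irrefl (r ▹ g) zero    = refl
edge-irrefl (r ▹ g) (suc i) = edge-irrefl g i

⟦_⟧ : Code n → Graph n
⟦ g ⟧ = record { adj = edge g ; sym = edge-sym g ; irrefl = edge-irrefl g }

encode : (Fin n → Fin n → Bool) → Code n
encode {zero}  a = ∅
encode {suc n} a = tabulate (λ j → a zero (suc j)) ▹ encode (λ i j → a (suc i) (suc j))

code : Graph n → Code n
code G = encode (adj G)

edge-encode : (a : Fin n → Fin n → Bool) → (∀ i j → a i j ≡ a j i) → (∀ i → a i i ≡ false) →
              ∀ i j → a i j ≡ edge (encode a) i j
edge-encode a a-sym a-irr zero    zero    = a-irr zero
edge-encode a a-sym a-irr zero    (suc j) = ≡-sym (lookup∘tabulate _ j)
edge-encode a a-sym a-irr (suc i) zero    = trans (a-sym (suc i) zero) (≡-sym (lookup∘tabulate _ i))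
edge-encode a a-sym a-irr (suc i) (suc j) =
  edge-encode _ (λ x y → a-sym (suc x) (suc y)) (a-irr ∘ suc) i j

≅-code : (G : Graph n) → G ≅ ⟦ code G ⟧
≅-code G = id , injective⇒bijective id , edge-encode (adj G) (Graph.sym G) (irrefl G)

-- Backtracking search for homomorphisms and isomorphisms

-- ok b x y says that two distinct vertices with adjacency b may be sent to x and y.
module Search (ok : Bool → Fin m → Fin m → Bool) where

  fits : Vec Bool n → Vec (Fin m) n → Fin m → Bool
  fits []      []       x = true
  fits (b ∷ r) (y ∷ ys) x = ok b x y ∧ fits r ys x

  -- Vertex `zero` of `r ▹ g` is placed last, on top of a map of `g`, so a partial map that breaks a
  -- constraint is pruned at once.
  maps : Code n → List (Vec (Fin m) n)
  maps ∅       = [] ∷ []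
  maps (r ▹ g) = concatMap (λ ys → List.map (_∷ ys) (filterᵇ (fits r ys) (allFin m))) (maps g)

  Compatible : Code n → (Fin n → Fin m) → Set
  Compatible g f = ∀ {i j} → i ≢ j → T (ok (edge g i j) (f i) (f j))

  fits⁻ : ∀ (r : Vec Bool n) ys {x} → T (fits r ys x) → ∀ j → T (ok (lookup r j) x (lookup ys j))
  fits⁻ (b ∷ r) (y ∷ ys) t zero    = proj₁ (to T-∧ t)
  fits⁻ (b ∷ r) (y ∷ ys) {x} t (suc j) = fits⁻ r ys (proj₂ (to (T-∧ {ok b x y}) t)) j

  fits⁺ : ∀ (r : Vec Bool n) {f x} → (∀ j → T (ok (lookup r j) x (f j))) → T (fits r (tabulate f) x)
  fits⁺ []      t = _
  fits⁺ (b ∷ r) t = from T-∧ (t zero , fits⁺ r (t ∘ suc))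

  maps⁺ : (g : Code n) → ∀ {f} → Compatible g f → tabulate f ∈ maps g
  maps⁺ ∅       c = here refl
  maps⁺ (r ▹ g) {f} c = ∈-concatMap⁺ _ (Any.map extend (maps⁺ g (λ i≢j → c (i≢j ∘ suc-injective))))
    where
    extend : ∀ {ys} → tabulate (f ∘ suc) ≡ ys →
             tabulate f ∈ List.map (_∷ ys) (filterᵇ (fits r ys) (allFin m))
    extend refl = ∈-map⁺ _ (∈-filter⁺ (T? ∘ _) (∈-allFin _) (fits⁺ r (λ j → c λ ())))

  module _ (ok-sym : ∀ {b x y} → T (ok b x y) → T (ok b y x)) where

    -- The search tests each pair in a single order, newer vertex first; `ok-sym` supplies the other
    -- order.
    maps⁻ : (g : Code n) → ∀ {xs} → xs ∈ maps g → Compatible g (lookup xs)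
    maps⁻ (r ▹ g) xs∈ {i} {j} i≢j
      with ys , ys∈ , xs∈ys▹ ← find (∈-concatMap⁻ _ {xs = maps g} xs∈)
      with x , x∈ , refl ← ∈-map⁻ _ xs∈ys▹
      with _ , x-fits ← ∈-filter⁻ (T? ∘ fits r ys) {xs = allFin m} x∈
      with i | j
    ... | zero   | zero   = contradiction refl i≢j
    ... | zero   | suc j′ = fits⁻ r ys x-fits j′
    ... | suc i′ | zero   = ok-sym (fits⁻ r ys x-fits i′)
    ... | suc i′ | suc j′ = maps⁻ g ys∈ (i≢j ∘ cong suc)

-- `isoOk` also demands distinct images, so whatever `isos` finds is injective, hence bijective when
-- both graphs have the same size.
homOk isoOk : Code m → Bool → Fin m → Fin m → Bool
homOk h b x y = not b ∨ edge h x y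
isoOk h b x y = ⌊ (b Bool.≟ edge h x y) ×-dec ¬? (x Fin.≟ y) ⌋

homs isos : Code n → Code m → List (Vec (Fin m) n)
homs g h = Search.maps (homOk h) g
isos g h = Search.maps (isoOk h) g

homs⁺ : (g : Code n) (h : Code m) → ∀ {f} → IsHom ⟦ g ⟧ ⟦ h ⟧ f → tabulate f ∈ homs g h
homs⁺ g h f-hom = Search.maps⁺ (homOk h) g (λ {i} {j} _ → implies (edge g i j) (f-hom i j))
  where
  implies : ∀ b {e} → (b ≡ true → e ≡ true) → T (not b ∨ e)
  implies true  b⇒e = from T-≡ (b⇒e refl)
  implies false b⇒e = _

homs⁻ : (g : Code n) (h : Code m) → ∀ {xs} → xs ∈ homs g h → IsHom ⟦ g ⟧ ⟦ h ⟧ (lookup xs)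
homs⁻ g h xs∈ i j e =
  to T-≡ (subst (λ b → T (not b ∨ edge h _ _)) e (Search.maps⁻ (homOk h) ok-sym g xs∈ i≢j))
  where
  ok-sym : ∀ {b x y} → T (homOk h b x y) → T (homOk h b y x)
  ok-sym {b} = subst (λ e → T (not b ∨ e)) (edge-sym h _ _)
  i≢j : i ≢ j
  -- An edge has distinct ends, which brings the pair within the range of `Compatible`.
  i≢j refl with () ← trans (≡-sym e) (edge-irrefl g i)

-- An empty `isos g h` thereby refutes isomorphism, which is how the ten graphs are told apart.
isos⁺ : (g h : Code n) → ⟦ g ⟧ ≅ ⟦ h ⟧ → ∃[ xs ] xs ∈ isos g h
isos⁺ g h (f , f-bij , f-adj) =
  tabulate f , Search.maps⁺ (isoOk h) g (λ i≢j → fromWitness (f-adj _ _ , i≢j ∘ proj₁ f-bij))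

isos⁻ : (g h : Code n) → ∀ {xs} → xs ∈ isos g h → ⟦ g ⟧ ≅ ⟦ h ⟧
isos⁻ g h {xs} xs∈ = lookup xs , injective⇒bijective f-inj , f-adj
  where
  ok-sym : ∀ {b x y} → T (isoOk h b x y) → T (isoOk h b y x)
  ok-sym t with b≡e , x≢y ← toWitness t = fromWitness (trans b≡e (edge-sym h _ _) , x≢y ∘ ≡-sym)
  compatible : ∀ {i j} → i ≢ j →
    edge g i j ≡ edge h (lookup xs i) (lookup xs j) × lookup xs i ≢ lookup xs j
  compatible i≢j = toWitness (Search.maps⁻ (isoOk h) ok-sym g xs∈ i≢j)
  f-inj : Injective _≡_ _≡_ (lookup xs)
  f-inj {i} {j} eq = decidable-stable (i Fin.≟ j) (λ i≢j → proj₂ (compatible i≢j) eq)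
  f-adj : ∀ i j → edge g i j ≡ edge h (lookup xs i) (lookup xs j)
  f-adj i j with i Fin.≟ j
  ... | no i≢j   = proj₁ (compatible i≢j)
  -- The diagonal lies outside the search; both sides are `false` there.
  ... | yes refl = trans (edge-irrefl g i) (≡-sym (edge-irrefl h _))

-- Deciding whether a graph is a core

unique? : (xs : Vec (Fin m) n) → Dec (Unique xs)
unique? = allPairs? (λ x y → ¬? (x Fin.≟ y))

-- Distinct entries mean injectivity, which for self-maps of a finite vertex set amounts to
-- bijectivity.
isCore? : Code n → Bool
isCore? g = all (λ xs → ⌊ unique? xs ⌋) (homs g g)

isCore⁺ : (g : Code n) → IsCore ⟦ g ⟧ → T (isCore? g)
isCore⁺ g g-core = All.all⁻ _ (All.tabulate λ {xs} xs∈ → fromWitness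
  (subst Unique (tabulate∘lookup xs)
    (Unique.tabulate⁺ (proj₁ (g-core (lookup xs) (homs⁻ g g xs∈))))))

isCore⁻ : (g : Code n) → T (isCore? g) → IsCore ⟦ g ⟧
isCore⁻ g t f f-hom = injective⇒bijective λ {x} {y} fx≡fy → Unique.lookup-injective f-unique x y
  (trans (lookup∘tabulate f x) (trans fx≡fy (≡-sym (lookup∘tabulate f y))))
  where
  f-unique : Unique (tabulate f)
  f-unique = toWitness (All.lookup (All.all⁺ _ (homs g g) t) (homs⁺ g g f-hom))

-- Representatives of the isomorphism classes

increment : Vec Bool n → Vec ℕ n → Vec ℕ n
increment []          []       = []
increment (true  ∷ r) (d ∷ ds) = suc d ∷ increment r ds
increment (false ∷ r) (d ∷ ds) = d ∷ increment r ds

degrees : Code n → Vec ℕ n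
degrees ∅       = []
degrees (r ▹ g) = Vec.count (Bool._≟ true) r ∷ increment r (degrees g)

-- The degree multiset packed into one number. It only lets _≈?_ skip hopeless searches: nothing
-- depends on its being an isomorphism invariant.
degreeKey : Code n → ℕ
degreeKey g = Vec.foldr′ (λ d k → 10 ^ d + k) 0 (degrees g)

_≈?_ : Code n → Code n → Bool
g ≈? h = (degreeKey g ≡ᵇ degreeKey h) ∧ not (null (isos g h))

-- An unwarranted `false` from `≈?` can only leave duplicates in `nub` or make a check fail;
-- correctness rests on the answer `true`.
≈?-sound : (g h : Code n) → T (g ≈? h) → ⟦ g ⟧ ≅ ⟦ h ⟧
≈?-sound g h t with isos g h in eq | proj₂ (to (T-∧ {degreeKey g ≡ᵇ degreeKey h}) t)
... | xs ∷ _ | _ = isos⁻ g h {xs} (subst (xs ∈_) (≡-sym eq) (here refl))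

nub : List (Code n) → List (Code n)
nub []       = []
nub (g ∷ gs) with nub gs
... | hs = if any (g ≈?_) hs then hs else g ∷ hs

-- `nub` discards `g` only when a retained `h` is isomorphic to it, so by transitivity each class
-- met by `gs` keeps a member.
nub⁺ : ∀ (G : Graph n) gs → Any (λ g → G ≅ ⟦ g ⟧) gs → Any (λ g → G ≅ ⟦ g ⟧) (nub gs)
nub⁺ G (g ∷ gs) p with any (g ≈?_) (nub gs) in eq | p
... | false | here G≅g  = here G≅g
... | false | there G≅gs = there (nub⁺ G gs G≅gs)
... | true  | there G≅gs = nub⁺ G gs G≅gs
... | true  | here G≅g  = Any.map (λ {h} t → ≅-trans G ⟦ g ⟧ ⟦ h ⟧ G≅g (≈?-sound g h t))
                            (Any.any⁻ _ (nub gs) (from T-≡ eq))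

rows : ∀ n → List (Vec Bool n)
rows zero    = [] ∷ []
rows (suc n) = cartesianProductWith _∷_ (false ∷ true ∷ []) (rows n)

∈-rows : (r : Vec Bool n) → r ∈ rows n
∈-rows []          = here refl
∈-rows (false ∷ r) = ∈-cartesianProductWith⁺ _∷_ {xs = false ∷ true ∷ []} (here refl) (∈-rows r)
∈-rows (true  ∷ r) = ∈-cartesianProductWith⁺ _∷_ {xs = false ∷ true ∷ []} (there (here refl)) (∈-rows r)

extensions : List (Code n) → List (Code (suc n))
extensions {n} gs = cartesianProductWith (λ g r → r ▹ g) gs (rows n)

representatives : ∀ n → List (Code n)
representatives zero    = ∅ ∷ []
representatives (suc n) = nub (extensions (representatives n))

-- The new vertex stays fixed and its row is carried along the inverse of `f`. Hence extending one
-- representative per class reaches every larger graph up to isomorphism.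
▹-cong : ∀ r (g h : Code n) → ⟦ g ⟧ ≅ ⟦ h ⟧ → ∃[ r′ ] ⟦ r ▹ g ⟧ ≅ ⟦ r′ ▹ h ⟧
▹-cong {n} r g h (f , f-bij , f-adj) = r′ , lift , injective⇒bijective lift-inj , lift-adj
  where
  open Inverse f-bij
  r′ : Vec Bool n
  r′ = tabulate (lookup r ∘ inv)
  r′∘f : ∀ i → lookup r i ≡ lookup r′ (f i)
  r′∘f i = ≡-sym (trans (lookup∘tabulate _ (f i)) (cong (lookup r) (inv∘f i)))
  lift : Fin (suc n) → Fin (suc n)
  lift zero    = zero
  lift (suc i) = suc (f i)
  lift-inj : Injective _≡_ _≡_ lift
  lift-inj {zero}  {zero}  _  = refl
  lift-inj {suc i} {suc j} eq = cong suc (proj₁ f-bij (suc-injective eq))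
  lift-adj : ∀ x y → edge (r ▹ g) x y ≡ edge (r′ ▹ h) (lift x) (lift y)
  lift-adj zero    zero    = refl
  lift-adj zero    (suc j) = r′∘f j
  lift-adj (suc i) zero    = r′∘f i
  lift-adj (suc i) (suc j) = f-adj i j

mutual
  -- Recursion on the code: its tail is matched to a representative, which some row extends to a
  -- copy of the whole graph.
  ∈-extensions : (g : Code (suc n)) → Any (λ h → ⟦ g ⟧ ≅ ⟦ h ⟧) (extensions (representatives n))
  ∈-extensions (r ▹ g) with h , h∈ , g≅h ← find (∈-representatives g)
                       with r′ , rg≅r′h ← ▹-cong r g h g≅h =
    lose (∈-cartesianProductWith⁺ _ h∈ (∈-rows r′)) rg≅r′h

  ∈-representatives : (g : Code n) → Any (λ h → ⟦ g ⟧ ≅ ⟦ h ⟧) (representatives n)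
  ∈-representatives ∅       = here (id , injective⇒bijective id , λ ())
  ∈-representatives (r ▹ g) = nub⁺ ⟦ r ▹ g ⟧ _ (∈-extensions (r ▹ g))

-- The top level is left without `nub`: each extension is either shown not to be a core or matched
-- to `cs`, and extensions are never compared with one another.
listsCores? : List (Code (suc n)) → Bool
listsCores? {n} cs = all (λ g → not (isCore? g) ∨ any (g ≈?_) cs) (extensions (representatives n))

listsCores⁻ : (cs : List (Code (suc n))) → listsCores? cs ≡ true →
              (G : Graph (suc n)) → IsCore G → Any (λ c → G ≅ ⟦ c ⟧) cs
listsCores⁻ {n} cs eq G G-core
  with g , g∈ , G≅g ← find (∈-extensions (code G))
  with G≅g ← ≅-trans G ⟦ code G ⟧ ⟦ g ⟧ (≅-code G) G≅g
  with isCore? g | isCore⁺ g (IsCore-resp-≅ G ⟦ g ⟧ G≅g G-core)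
     | All.lookup (All.all⁺ _ (extensions (representatives n)) (from T-≡ eq)) g∈
-- The case `false` is void by `isCore⁺`; for `true` the tested disjunction reduces to its right
-- side.
... | true | _ | listed =
  Any.map (λ {c} g≈c → ≅-trans G ⟦ g ⟧ ⟦ c ⟧ G≅g (≈?-sound g c g≈c)) (Any.any⁻ _ cs listed)

areCores? : (Fin m → Code n) → Bool
areCores? c = all (λ i → isCore? (c i)) (allFin _)

areCores⁻ : (c : Fin m → Code n) → areCores? c ≡ true → ∀ i → IsCore ⟦ c i ⟧
areCores⁻ {m} c eq i = isCore⁻ (c i) (All.lookup (All.all⁺ _ (allFin m) (from T-≡ eq)) (∈-allFin i))

null-∉ : ∀ {A : Set} {x : A} {xs} → T (null xs) → ¬ x ∈ xs
null-∉ {xs = []} _ ()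

-- Equal indices are exempted because every graph is isomorphic to itself.
pairwiseNonIso? : (Fin m → Code n) → Bool
pairwiseNonIso? c = all (λ i → all (λ j → ⌊ i Fin.≟ j ⌋ ∨ null (isos (c i) (c j))) (allFin _)) (allFin _)

pairwiseNonIso⁻ : (c : Fin m → Code n) → pairwiseNonIso? c ≡ true → ∀ i j → ⟦ c i ⟧ ≅ ⟦ c j ⟧ → i ≡ j
pairwiseNonIso⁻ {m} c eq i j cᵢ≅cⱼ
  with rowᵢ ← All.lookup (All.all⁺ _ (allFin m) (from T-≡ eq)) (∈-allFin i)
  with to T-∨ (All.lookup (All.all⁺ _ (allFin m) rowᵢ) (∈-allFin j))
... | inj₁ i≡j  = toWitness i≡j
... | inj₂ none = contradiction (proj₂ (isos⁺ (c i) (c j) cᵢ≅cⱼ)) (null-∉ none)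

-- The ten cores

coreCode : Fin 10 → Code 7
coreCode i = code (coreGraph i)

-- Left transparent, these proofs of closed equations invite the type checker to rerun the computation.
abstract
  coreCodes-list : listsCores? (List.tabulate coreCode) ≡ true
  coreCodes-list = refl

  coreCodes-areCores : areCores? coreCode ≡ true
  coreCodes-areCores = refl

  coreCodes-pairwiseNonIso : pairwiseNonIso? coreCode ≡ true
  coreCodes-pairwiseNonIso = refl

coreGraph-injective : ∀ i j → coreGraph i ≅ coreGraph j → i ≡ j
coreGraph-injective i j Gᵢ≅Gⱼ =
  pairwiseNonIso⁻ coreCode coreCodes-pairwiseNonIso i j
    (≅-trans ⟦ coreCode i ⟧ (coreGraph i) ⟦ coreCode j ⟧
      (≅-sym (coreGraph i) ⟦ coreCode i ⟧ (≅-code (coreGraph i)))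
      (≅-trans (coreGraph i) (coreGraph j) ⟦ coreCode j ⟧ Gᵢ≅Gⱼ (≅-code (coreGraph j))))

theorem5p8 : ((G : Graph 7) → IsCore G ⇔ (∃ λ (i : Fin 10) → G ≅ coreGraph i))
    × (∀ (i j : Fin 10) → coreGraph i ≅ coreGraph j → i ≡ j)
theorem5p8 = (λ G → mk⇔ (listed G) (isCore G)) , coreGraph-injective
  where
  listed : ∀ G → IsCore G → ∃ λ i → G ≅ coreGraph i
  listed G G-core = map₂
    (λ {i} G≅code → ≅-trans G ⟦ coreCode i ⟧ (coreGraph i) G≅code
                      (≅-sym (coreGraph i) ⟦ coreCode i ⟧ (≅-code (coreGraph i))))
    -- The position in the tabulated list is the required index `i`.
    (Any.tabulate⁻ {P = λ c → G ≅ ⟦ c ⟧} {f = coreCode}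
      (listsCores⁻ (List.tabulate coreCode) coreCodes-list G G-core))

  isCore : ∀ G → (∃ λ i → G ≅ coreGraph i) → IsCore G
  -- The check ran on codes; its outcome is carried to `G` along the isomorphism.
  isCore G (i , G≅Gᵢ) = IsCore-resp-≅ ⟦ coreCode i ⟧ G
    (≅-sym G ⟦ coreCode i ⟧ (≅-trans G (coreGraph i) ⟦ coreCode i ⟧ G≅Gᵢ (≅-code (coreGraph i))))
    (areCores⁻ coreCode coreCodes-areCores i)
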